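{- Let $G^\sigma$ be a connected oriented graph of order $n\in\{2,3,4\}$ with $sr(G^\sigma)=2$. Then: (1) if $n=2$, $G^\sigma$ is the path $P_2^\sigma$ with arbitrary orientation; (2) if $n=3$, the underlying graph is $K_3$ or $P_3$ (with any orientation of the edges); (3) if $n=4$, $G^\sigma$ is one of: (a) an evenly-oriented cycle $C_4^\sigma$; (b) an orientation (arbitrary) of the star $K_{1,3}$; (c) an evenly-oriented orientation of $K_{1,1,2}$ (i.e. an orientation of $K_4$ minus an edge in which every cycle of length $4$ is evenly-oriented).
   Context: An oriented graph $G^\sigma$ is a simple graph $G$ (underlying graph) together with an orientation of each edge. Its skew-adjacency matrix $S(G^\sigma)=(s_{ij})$ has $s_{ij}=1$ if there is an arc from $v_i$ to $v_j$, $s_{ij}=-1$ if there is an arc from $v_j$ to $v_i$, and $0$ otherwise; the skew-rank $sr(G^\sigma)$ is the rank of $S(G^\sigma)$. For an even cycle $u_1\cdots u_ku_1$, its sign is the sign of $\prod_{i=1}^k s_{u_iu_{i+1}}$ ($u_{k+1}=u_1$); the cycle is evenly-oriented if this sign is positive. An oriented graph is evenly-oriented if every even cycle in it is evenly-oriented. $P_n$, $C_n$, $K_n$ denote path, cycle, complete graph on $n$ vertices; $K_{1,1,2}$ is the complete tripartite graph with parts of sizes $1,1,2$. -}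

module Defs where

open import Level using (0ℓ)
open import Data.Bool.Base using (if_then_else_)
open import Data.Fin.Base using (Fin; toℕ)
open import Data.Nat.Base using (ℕ; suc; _≤_)
open import Data.Nat.Divisibility using (_∣_)
open import Data.Nat.DivMod using (_mod_)
open import Data.Nat.Properties using (1+n≢n)
open import Data.Product.Base using (Σ; ∃; _×_; _,_; proj₁)
open import Data.Rational.Base
  using (ℚ; 0ℚ; 1ℚ; -_; _*_; _<_; +-0-rawMonoid; *-1-rawMonoid)
open import Data.Sum.Base using (_⊎_; inj₁; inj₂; swap)
open import Data.Vec.Base using (Vec; lookup)
open import Data.Vec.Functional using (Vector)
open import Function.Base using (_∘_)
open import Function.Bundles using (_↔_; _⇔_; module Inverse)
open import Function.Definitions using (Injective)
open import Relation.Binary.Core using (Rel)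
open import Relation.Binary.Construct.Closure.ReflexiveTransitive using (Star)
open import Relation.Binary.Definitions
  using (Asymmetric; Decidable; Irreflexive; Symmetric)
open import Relation.Binary.PropositionalEquality
  using (_≡_; _≢_; refl; sym; ≢-sym)
open import Relation.Nullary.Decidable using (does)

open import Algebra.Definitions.RawMonoid +-0-rawMonoid public using (sum)
open import Algebra.Definitions.RawMonoid *-1-rawMonoid public
  using () renaming (sum to product)

record SimpleGraph (V : Set) : Set₁ where
  field
    Adj    : Rel V 0ℓ
    symm   : Symmetric Adj
    irrefl : Irreflexive _≡_ Adj

open SimpleGraph public

record _≅_ {V W : Set} (G : SimpleGraph V) (H : SimpleGraph W) : Set where
  field
    bijection : V ↔ W
    preserves : ∀ u v →
      Adj G u v ⇔ Adj H (Inverse.to bijection u) (Inverse.to bijection v)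

infix 4 _≅_

Connected : {V : Set} → SimpleGraph V → Set
Connected G = ∀ u v → Star (Adj G) u v

-- The cyclic successor on {0, …, n-1}: i ↦ i + 1 mod n.
next : ∀ {n} → Fin n → Fin n
next {suc n} i = suc (toℕ i) mod suc n

P : ∀ n → SimpleGraph (Fin n)
P n = record
  { Adj    = λ i j → toℕ j ≡ suc (toℕ i) ⊎ toℕ i ≡ suc (toℕ j)
  ; symm   = swap
  ; irrefl = λ { refl (inj₁ e) → 1+n≢n (sym e) ; refl (inj₂ e) → 1+n≢n (sym e) }
  }

-- The cycle for n ≥ 3. The condition i ≢ j only has an effect for n = 1,
-- where it rules out a loop.
C : ∀ n → SimpleGraph (Fin n)
C n = record
  { Adj    = λ i j → i ≢ j × (j ≡ next i ⊎ i ≡ next j)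
  ; symm   = λ (i≢j , e) → ≢-sym i≢j , swap e
  ; irrefl = λ i≡j (i≢j , _) → i≢j i≡j
  }

K : ∀ n → SimpleGraph (Fin n)
K n = record
  { Adj    = _≢_
  ; symm   = ≢-sym
  ; irrefl = λ i≡j i≢j → i≢j i≡j
  }

-- The complete multipartite graph with the given part sizes. The vertex
-- (p , x) is the x-th vertex of the p-th part.
multipartite : ∀ {k} (sizes : Vec ℕ k) →
               SimpleGraph (Σ (Fin k) λ p → Fin (lookup sizes p))
multipartite sizes = record
  { Adj    = λ u v → proj₁ u ≢ proj₁ v
  ; symm   = ≢-sym
  ; irrefl = λ { refl p≢p → p≢p refl }
  }

-- Arcs are decidable so that the entries of the skew-adjacency matrix can
-- be computed; decidability of adjacency follows.
record OrientedGraph (n : ℕ) : Set₁ where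
  field
    underlying : SimpleGraph (Fin n)
    Arc        : Rel (Fin n) 0ℓ
    arc?       : Decidable Arc
    arc-asym   : Asymmetric Arc
    arc⇔adj    : ∀ i j → (Arc i j ⊎ Arc j i) ⇔ Adj underlying i j

open OrientedGraph public

Matrix : ℕ → ℕ → Set
Matrix m n = Fin m → Fin n → ℚ

column : ∀ {m n} → Matrix m n → Fin n → Vector ℚ m
column A j i = A i j

LinearlyIndependent : ∀ {k m} → (Fin k → Vector ℚ m) → Set
LinearlyIndependent {k} v =
  (a : Fin k → ℚ) →
  (∀ i → sum (λ j → a j * v j i) ≡ 0ℚ) →
  ∀ j → a j ≡ 0ℚ

-- The rank is the maximal number of linearly independent columns. A choice
-- of columns may repeat an index, but an independent family cannot.
HasRank : ∀ {m n} → Matrix m n → ℕ → Set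
HasRank {n = n} A r =
  (∃ λ (c : Fin r → Fin n) → LinearlyIndependent (column A ∘ c)) ×
  (∀ {k} (c : Fin k → Fin n) → LinearlyIndependent (column A ∘ c) → k ≤ r)

-- All entries are 0 or ±1, so the rank over ℚ is also the rank over ℝ.
skewAdjacency : ∀ {n} → OrientedGraph n → Matrix n n
skewAdjacency G i j =
  if does (arc? G i j) then 1ℚ else
  if does (arc? G j i) then - 1ℚ else 0ℚ

HasSkewRank : ∀ {n} → OrientedGraph n → ℕ → Set
HasSkewRank G = HasRank (skewAdjacency G)

record Cycle {V : Set} (G : SimpleGraph V) (k : ℕ) : Set where
  field
    3≤k      : 3 ≤ k
    vertex   : Fin k → V
    distinct : Injective _≡_ _≡_ vertex
    edge     : ∀ i → Adj G (vertex i) (vertex (next i))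

open Cycle public

cycleProduct : ∀ {n k} (G : OrientedGraph n) → Cycle (underlying G) k → ℚ
cycleProduct G c =
  product (λ i → skewAdjacency G (vertex c i) (vertex c (next i)))

EvenlyOriented : ∀ {n} → OrientedGraph n → Set
EvenlyOriented G =
  ∀ {k} → 2 ∣ k → (c : Cycle (underlying G) k) → 0ℚ < cycleProduct G c

{-# OPTIONS --safe #-}
-- For four vertices w, x, y, z the Pfaffian
--   s(w,x) s(y,z) − s(w,y) s(x,z) + s(w,z) s(x,y)
-- vanishes in skew-rank 2, since otherwise the four columns would be independent:
-- the adjugate of a skew 4 × 4 matrix recovers Pfaffian · a from the relations
-- satisfied by a coefficient vector a. Its three terms are 0 or ±1, so an even
-- number of them is nonzero, and if the outer two are nonzero they are opposite.
-- The second fact says that every 4-cycle is evenly-oriented. By the first, the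
-- number of perfect matchings on four vertices is even; together with the absence
-- of isolated vertices this leaves only C₄, K₁,₃ and K₁,₁,₂, by a finite check.
module Submission where

open import Defs
open import Data.Bool.Base using (Bool; true; false; _∧_; _xor_)
import Data.Bool.Properties as Bool
open import Data.Fin.Base using (Fin; zero; suc; punchIn)
open import Data.Fin.Patterns using (0F; 1F; 2F; 3F)
open import Data.Fin.Permutation as Permutation using (Permutation′; insert)
open import Data.Fin.Properties as Fin using (all?; any?; injective⇒≤; punchInᵢ≢i)
open import Data.Fin.Subset using (Subset)
open import Data.Fin.Subset.Properties using (anySubset?)
open import Data.List.Base using (List; [_]; allFin; cartesianProductWith)
open import Data.List.Relation.Unary.Any as Any using (Any)
open import Data.Nat.Base using (ℕ; zero; suc; _≤_; s≤s)
open import Data.Nat.Divisibility using (_∣_; _∣?_)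
import Data.Nat.Properties as ℕ
open import Data.Product.Base using (∃; _×_; _,_; proj₁)
open import Data.Rational.Base using (ℚ; 0ℚ; 1ℚ; _+_; _-_; _*_; -_; _<_)
open import Data.Rational.Properties using (_≟_; _<?_; *-zeroʳ; heytingCommutativeRing)
open import Data.Rational.Solver using (module +-*-Solver)
open import Algebra.Apartness.Properties.HeytingCommutativeRing heytingCommutativeRing
  using (x#0y#0→xy#0)
open import Data.Sum.Base as Sum using (_⊎_)
open import Data.Vec.Base using ([]; _∷_; lookup; tabulate)
open import Data.Vec.Properties using (lookup∘tabulate)
open import Function.Base using (_∘_; flip)
open import Function.Bundles using (_↔_; _⇔_; mk⇔; mk↔ₛ′; module Inverse)
open import Function.Construct.Composition using (_↔-∘_)
open import Function.Construct.Identity using (↔-id)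
open import Relation.Binary.Construct.Closure.ReflexiveTransitive using (ε; _◅_)
open import Relation.Binary.Definitions using () renaming (Decidable to Decidable₂)
open import Relation.Binary.PropositionalEquality
  using (_≡_; refl; sym; trans; cong; cong₂; subst)
open import Relation.Nullary using (Dec; yes; no; does; contradiction)
open import Relation.Nullary.Decidable
  using (map; map′; ¬?; _×-dec_; _⊎-dec_; _→-dec_; decidable-stable; dec-true; dec-false; does-⇔;
         from-yes; from-no)
open import Relation.Unary using (Decidable)

private
  variable
    n : ℕ

-- Adjacency as a Boolean function

adj? : (G : OrientedGraph n) → Decidable₂ (Adj (underlying G))
adj? G i j = map (arc⇔adj G i j) (arc? G i j ⊎-dec arc? G j i)

adjacent : (G : OrientedGraph n) → Fin n → Fin n → Bool
adjacent G i j = does (adj? G i j)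

adjacent-true : (G : OrientedGraph n) → ∀ {i j} → Adj (underlying G) i j → adjacent G i j ≡ true
adjacent-true G {i} {j} = dec-true (adj? G i j)

adjacent-sym : (G : OrientedGraph n) → ∀ i j → adjacent G i j ≡ adjacent G j i
adjacent-sym G i j =
  does-⇔ (mk⇔ (symm (underlying G)) (symm (underlying G))) (adj? G i j) (adj? G j i)

adjacent-irrefl : (G : OrientedGraph n) → ∀ i → adjacent G i i ≡ false
adjacent-irrefl G i = dec-false (adj? G i i) (irrefl (underlying G) refl)

-- Skew-adjacency entries and the Pfaffian

skew : (G : OrientedGraph n) → ∀ i j → skewAdjacency G j i ≡ - skewAdjacency G i j
skew G i j with arc? G i j | arc? G j i
... | yes a | yes b = contradiction b (arc-asym G a)
... | yes _ | no  _ = refl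
... | no  _ | yes _ = refl
... | no  _ | no  _ = refl

skew-diagonal : (G : OrientedGraph n) → ∀ i → skewAdjacency G i i ≡ 0ℚ
skew-diagonal G i with arc? G i i
... | yes a = contradiction a (arc-asym G a)
... | no  _ = refl

pfaffian : Matrix n n → (Fin 4 → Fin n) → ℚ
pfaffian A v =
  A (v 0F) (v 1F) * A (v 2F) (v 3F) - A (v 0F) (v 2F) * A (v 1F) (v 3F) +
  A (v 0F) (v 3F) * A (v 1F) (v 2F)

combination-zero : ∀ p q r {x y z} → x ≡ 0ℚ → y ≡ 0ℚ → z ≡ 0ℚ → p * x + q * y + r * z ≡ 0ℚ
combination-zero p q r refl refl refl =
  cong₂ _+_ (cong₂ _+_ (*-zeroʳ p) (*-zeroʳ q)) (*-zeroʳ r)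

-- The coefficients of the combinations of rows are the columns of the adjugate
-- divided by the Pfaffian.
pfaffian-annihilates :
  (G : OrientedGraph n) (v : Fin 4 → Fin n) (a : Fin 4 → ℚ) →
  (∀ i → sum (λ j → a j * skewAdjacency G (v i) (v j)) ≡ 0ℚ) →
  ∀ j → pfaffian (skewAdjacency G) v * a j ≡ 0ℚ
pfaffian-annihilates G v a relation = λ where
    -- The adjugate of a skew 4 × 4 matrix is itself skew. Its zero diagonal is why row `j` is
    -- absent from the combination for index `j`.
    0F → trans
      (solve 10 (λ a b c d e f w x y z →
        (a :* f :- b :* e :+ c :* d) :* w :=
        (:- f) :* row₁ a b c d e f w x y z :+ e :* row₂ a b c d e f w x y z :+
        (:- d) :* row₃ a b c d e f w x y z) refl
        s₀₁ s₀₂ s₀₃ s₁₂ s₁₃ s₂₃ (a 0F) (a 1F) (a 2F) (a 3F))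
      (combination-zero (- s₂₃) s₁₃ (- s₁₂) relation₁ relation₂ relation₃)
    1F → trans
      (solve 10 (λ a b c d e f w x y z →
        (a :* f :- b :* e :+ c :* d) :* x :=
        f :* row₀ a b c d e f w x y z :+ (:- c) :* row₂ a b c d e f w x y z :+
        b :* row₃ a b c d e f w x y z) refl
        s₀₁ s₀₂ s₀₃ s₁₂ s₁₃ s₂₃ (a 0F) (a 1F) (a 2F) (a 3F))
      (combination-zero s₂₃ (- s₀₃) s₀₂ relation₀ relation₂ relation₃)
    2F → trans
      (solve 10 (λ a b c d e f w x y z →
        (a :* f :- b :* e :+ c :* d) :* y :=
        (:- e) :* row₀ a b c d e f w x y z :+ c :* row₁ a b c d e f w x y z :+
        (:- a) :* row₃ a b c d e f w x y z) refl
        s₀₁ s₀₂ s₀₃ s₁₂ s₁₃ s₂₃ (a 0F) (a 1F) (a 2F) (a 3F))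
      (combination-zero (- s₁₃) s₀₃ (- s₀₁) relation₀ relation₁ relation₃)
    3F → trans
      (solve 10 (λ a b c d e f w x y z →
        (a :* f :- b :* e :+ c :* d) :* z :=
        d :* row₀ a b c d e f w x y z :+ (:- b) :* row₁ a b c d e f w x y z :+
        a :* row₂ a b c d e f w x y z) refl
        s₀₁ s₀₂ s₀₃ s₁₂ s₁₃ s₂₃ (a 0F) (a 1F) (a 2F) (a 3F))
      (combination-zero s₁₂ (- s₀₂) s₀₁ relation₀ relation₁ relation₂)
  where
  open +-*-Solver

  s₀₁ = skewAdjacency G (v 0F) (v 1F)
  s₀₂ = skewAdjacency G (v 0F) (v 2F)
  s₀₃ = skewAdjacency G (v 0F) (v 3F)
  s₁₂ = skewAdjacency G (v 1F) (v 2F)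
  s₁₃ = skewAdjacency G (v 1F) (v 3F)
  s₂₃ = skewAdjacency G (v 2F) (v 3F)

  -- Here `a` to `f` stand for the six entries above the diagonal and `w` to `z` for the
  -- coefficients. The bracketing and the trailing zero copy the unfolding of `sum` on `Fin 4`.
  row₀ row₁ row₂ row₃ : (a b c d e f w x y z : Polynomial 10) → Polynomial 10
  row₀ a b c d e f w x y z = w :* con 0ℚ :+ (x :* a :+ (y :* b :+ (z :* c :+ con 0ℚ)))
  row₁ a b c d e f w x y z = w :* (:- a) :+ (x :* con 0ℚ :+ (y :* d :+ (z :* e :+ con 0ℚ)))
  row₂ a b c d e f w x y z = w :* (:- b) :+ (x :* (:- d) :+ (y :* con 0ℚ :+ (z :* f :+ con 0ℚ)))
  row₃ a b c d e f w x y z = w :* (:- c) :+ (x :* (:- e) :+ (y :* (:- f) :+ (z :* con 0ℚ :+ con 0ℚ)))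

  -- Entries on and below the diagonal are replaced by 0 and by negated upper entries, so that each
  -- relation has the shape of the corresponding `row`.
  relationWith : ∀ i (s : Fin 4 → ℚ) → (∀ j → skewAdjacency G (v i) (v j) ≡ s j) →
              sum (λ j → a j * s j) ≡ 0ℚ
  relationWith i s e = trans
    (cong₂ _+_ (term 0F) (cong₂ _+_ (term 1F) (cong₂ _+_ (term 2F) (cong₂ _+_ (term 3F) refl))))
    (relation i)
    where
    term : ∀ j → a j * s j ≡ a j * skewAdjacency G (v i) (v j)
    term j = cong (a j *_) (sym (e j))

  relation₀ = relationWith 0F (λ { 0F → 0ℚ ; 1F → s₀₁ ; 2F → s₀₂ ; 3F → s₀₃ }) λ where
    0F → skew-diagonal G (v 0F)
    1F → refl
    2F → refl
    3F → refl
  relation₁ = relationWith 1F (λ { 0F → - s₀₁ ; 1F → 0ℚ ; 2F → s₁₂ ; 3F → s₁₃ }) λ where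
    0F → skew G (v 0F) (v 1F)
    1F → skew-diagonal G (v 1F)
    2F → refl
    3F → refl
  relation₂ = relationWith 2F (λ { 0F → - s₀₂ ; 1F → - s₁₂ ; 2F → 0ℚ ; 3F → s₂₃ }) λ where
    0F → skew G (v 0F) (v 2F)
    1F → skew G (v 1F) (v 2F)
    2F → skew-diagonal G (v 2F)
    3F → refl
  relation₃ = relationWith 3F (λ { 0F → - s₀₃ ; 1F → - s₁₃ ; 2F → - s₂₃ ; 3F → 0ℚ }) λ where
    0F → skew G (v 0F) (v 3F)
    1F → skew G (v 1F) (v 3F)
    2F → skew G (v 2F) (v 3F)
    3F → skew-diagonal G (v 3F)

pfaffian-zero : (G : OrientedGraph n) → HasSkewRank G 2 → ∀ v → pfaffian (skewAdjacency G) v ≡ 0ℚ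
pfaffian-zero G (_ , bound) v = decidable-stable (_ ≟ 0ℚ) λ pf≢0 →
  -- With a nonzero Pfaffian, a nonzero coefficient would make their product nonzero, against
  -- `pfaffian-annihilates`. So the four columns at `v` are independent, and the rank bound would
  -- give 4 ≤ 2.
  contradiction
    (bound v λ a relation j → decidable-stable (a j ≟ 0ℚ) λ aⱼ≢0 →
      x#0y#0→xy#0 pf≢0 aⱼ≢0 (pfaffian-annihilates G v a (λ i → relation (v i)) j))
    λ { (s≤s (s≤s ())) }

-- Parity and sign of the Pfaffian terms

value : Fin 3 → ℚ
value 0F = 0ℚ
value 1F = 1ℚ
value 2F = - 1ℚ

support : Fin 3 → Bool
support 0F = false
support 1F = true
support 2F = true

-- One index fixes both the number and whether it is nonzero. Statements linking entries to
-- adjacency thus become finite checks over `Fin 3`.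
Ternary : ℚ → Bool → Set
Ternary x b = ∃ λ t → x ≡ value t × b ≡ support t

entry-ternary : (G : OrientedGraph n) → ∀ i j → Ternary (skewAdjacency G i j) (adjacent G i j)
entry-ternary G i j with arc? G i j | arc? G j i
... | yes _ | _     = 1F , refl , refl
... | no  _ | yes _ = 2F , refl , refl
... | no  _ | no  _ = 0F , refl , refl

*-ternary : ∀ {x y b c} → Ternary x b → Ternary y c → Ternary (x * y) (b ∧ c)
*-ternary (t , refl , refl) (u , refl , refl) =
  from-yes (all? λ t → all? λ u → any? λ w →
    value t * value u ≟ value w ×-dec support t ∧ support u Bool.≟ support w) t u

-- Modulo 2, the alternating sum counts its nonzero terms.
alternating-parity : ∀ {x y z b c d} → Ternary x b → Ternary y c → Ternary z d →
                     x - y + z ≡ 0ℚ → b xor c xor d ≡ false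
alternating-parity (t , refl , refl) (u , refl , refl) (w , refl , refl) =
  from-yes (all? λ t → all? λ u → all? λ w →
    value t - value u + value w ≟ 0ℚ →-dec
    support t xor support u xor support w Bool.≟ false) t u w

-- If `x` and `z` were equal and nonzero, `x + z` would be ±2, which `y` cannot be. Hence they are
-- opposite.
alternating-sign : ∀ {x y z b c d} → Ternary x b → Ternary y c → Ternary z d →
                   x - y + z ≡ 0ℚ → b ≡ true → d ≡ true → 0ℚ < - (x * z)
alternating-sign (t , refl , refl) (u , refl , refl) (w , refl , refl) =
  from-yes (all? λ t → all? λ u → all? λ w →
    value t - value u + value w ≟ 0ℚ →-dec
    (support t Bool.≟ true →-dec (support w Bool.≟ true →-dec
    0ℚ <? - (value t * value w)))) t u w

module _ (G : OrientedGraph n) (rank : HasSkewRank G 2) (v : Fin 4 → Fin n) where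
  private
    s : Fin 4 → Fin 4 → ℚ
    s i j = skewAdjacency G (v i) (v j)

    e : Fin 4 → Fin 4 → Bool
    e i j = adjacent G (v i) (v j)

    matching : ∀ i j k l → Ternary (s i j * s k l) (e i j ∧ e k l)
    matching i j k l =
      *-ternary (entry-ternary G (v i) (v j)) (entry-ternary G (v k) (v l))

  -- Each term of the Pfaffian is nonzero exactly when the corresponding perfect matching of the
  -- four positions consists of edges.
  matchings-even : (e 0F 1F ∧ e 2F 3F) xor (e 0F 2F ∧ e 1F 3F) xor (e 0F 3F ∧ e 1F 2F) ≡ false
  matchings-even = alternating-parity
    (matching 0F 1F 2F 3F) (matching 0F 2F 1F 3F) (matching 0F 3F 1F 2F)
    (pfaffian-zero G rank v)

  closed-walk-positive : (∀ i → e i (next i) ≡ true) → 0ℚ < product (λ i → s i (next i))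
  closed-walk-positive edges = subst (0ℚ <_) (sym rearrange)
    (alternating-sign
      (matching 0F 1F 2F 3F) (matching 0F 2F 1F 3F) (matching 0F 3F 1F 2F)
      (pfaffian-zero G rank v)
      (cong₂ _∧_ (edges 0F) (edges 2F))
      (cong₂ _∧_ (trans (adjacent-sym G (v 0F) (v 3F)) (edges 3F)) (edges 1F)))
    where
    open +-*-Solver
    -- The four edges of the walk split into the two opposite pairs that form the outer Pfaffian
    -- terms. The minus sign comes from traversing the closing edge from 3 to 0.
    rearrange : product (λ i → s i (next i)) ≡ - ((s 0F 1F * s 2F 3F) * (s 0F 3F * s 1F 2F))
    rearrange = trans
      (cong (λ x → s 0F 1F * (s 1F 2F * (s 2F 3F * (x * 1ℚ)))) (skew G (v 0F) (v 3F)))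
      (solve 4 (λ a b c d → a :* (b :* (c :* ((:- d) :* con 1ℚ))) :=
                            :- ((a :* c) :* (d :* b))) refl
        (s 0F 1F) (s 1F 2F) (s 2F 3F) (s 0F 3F))

-- Injectivity of the vertex map bounds the length by 4, so the only even length left is 4.
evenly-oriented : (G : OrientedGraph 4) → HasSkewRank G 2 → EvenlyOriented G
evenly-oriented G rank {k} 2∣k c = even-length k 2∣k c (3≤k c) (injective⇒≤ (distinct c))
  where
  even-length : ∀ k → 2 ∣ k → (c : Cycle (underlying G) k) → 3 ≤ k → k ≤ 4 →
                0ℚ < cycleProduct G c
  even-length 3 2∣3 _ _ _ = contradiction 2∣3 (from-no (2 ∣? 3))
  even-length 4 _   c _ _ = closed-walk-positive G rank (vertex c) (adjacent-true G ∘ edge c)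
  even-length (suc (suc (suc (suc (suc _))))) _ _ _ (s≤s (s≤s (s≤s (s≤s ()))))
  even-length 1 _ _ (s≤s ()) _
  even-length 2 _ _ (s≤s (s≤s ())) _

-- Finite check over all graphs on Fin n

-- The heads are the neighbourhoods of 0 among the later vertices.
data EdgeSet : ℕ → Set where
  []  : EdgeSet 0
  _∷_ : Subset n → EdgeSet n → EdgeSet (suc n)

mem : EdgeSet n → Fin n → Fin n → Bool
mem (p ∷ c) zero    zero    = false
mem (p ∷ c) zero    (suc j) = lookup p j
mem (p ∷ c) (suc i) zero    = lookup p i
mem (p ∷ c) (suc i) (suc j) = mem c i j

edgeSet : ∀ n → (Fin n → Fin n → Bool) → EdgeSet n
edgeSet zero    f = []
edgeSet (suc n) f = tabulate (f zero ∘ suc) ∷ edgeSet n (λ i j → f (suc i) (suc j))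

mem-edgeSet : (f : Fin n → Fin n → Bool) → (∀ i j → f i j ≡ f j i) → (∀ i → f i i ≡ false) →
              ∀ i j → mem (edgeSet n f) i j ≡ f i j
mem-edgeSet f symm irrefl zero    zero    = sym (irrefl zero)
mem-edgeSet f symm irrefl zero    (suc j) = lookup∘tabulate (f zero ∘ suc) j
mem-edgeSet f symm irrefl (suc i) zero    =
  trans (lookup∘tabulate (f zero ∘ suc) i) (symm zero (suc i))
mem-edgeSet f symm irrefl (suc i) (suc j) =
  mem-edgeSet (λ i j → f (suc i) (suc j)) (λ i j → symm (suc i) (suc j)) (irrefl ∘ suc) i j

-- The universal statement is decided as the absence of a counterexample, which is constructively
-- enough because `P` is decidable.
allSubset? : {P : Subset n → Set} → Decidable P → Dec (∀ p → P p)
allSubset? P? = map′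
  (λ ¬∃¬P p → decidable-stable (P? p) (λ ¬Pp → ¬∃¬P (p , ¬Pp)))
  (λ ∀P (p , ¬Pp) → ¬Pp (∀P p))
  (¬? (anySubset? (¬? ∘ P?)))

allEdgeSet? : {P : EdgeSet n → Set} → Decidable P → Dec (∀ c → P c)
allEdgeSet? {zero}  P? = map′ (λ { P[] [] → P[] }) (λ ∀P → ∀P []) (P? [])
allEdgeSet? {suc n} P? = map′
  (λ { ∀P (p ∷ c) → ∀P p c }) (λ ∀P p c → ∀P (p ∷ c))
  (allSubset? λ p → allEdgeSet? λ c → P? (p ∷ c))

-- A permutation is built from the image of 0 and a permutation of the remaining points.
permutations : ∀ n → List (Permutation′ n)
permutations zero    = [ Permutation.id ]
permutations (suc n) = cartesianProductWith (insert zero) (allFin (suc n)) (permutations n)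

-- The enumeration transfers the vertices to `Fin n`, so that an isomorphism can be sought among the
-- permutations of `Fin n`.
record Template (n : ℕ) : Set₁ where
  field
    {Vertex}    : Set
    graph       : SimpleGraph Vertex
    Adj?        : Decidable₂ (Adj graph)
    enumeration : Fin n ↔ Vertex

open Template

IsLabelling : Template n → EdgeSet n → Permutation′ n → Set
IsLabelling T c π = ∀ i j → mem c i j ≡ does (Adj? T (f i) (f j))
  where f = Inverse.to (enumeration T ↔-∘ π)

Realises : Template n → EdgeSet n → Set
Realises {n} T c = Any (IsLabelling T c) (permutations n)

realises? : (T : Template n) → Decidable (Realises T)
realises? T c = Any.any? (λ π → all? λ i → all? λ j → mem c i j Bool.≟ _) (permutations _)

-- This is the consequence of connectedness that enters the finite check; it is decided without
-- searching for walks.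
NoIsolated : EdgeSet n → Set
NoIsolated c = ∀ i → ∃ λ j → mem c i j ≡ true

noIsolated? : Decidable (NoIsolated {n})
noIsolated? c = all? λ i → any? λ j → mem c i j Bool.≟ true

EvenMatchings : EdgeSet 4 → Set
EvenMatchings c =
  (mem c 0F 1F ∧ mem c 2F 3F) xor (mem c 0F 2F ∧ mem c 1F 3F) xor (mem c 0F 3F ∧ mem c 1F 2F)
  ≡ false

evenMatchings? : Decidable EvenMatchings
evenMatchings? c = _ Bool.≟ false

-- Target graphs and the classification

path cycle complete : ∀ n → Template n
path n = record
  { graph       = P n
  ; Adj?        = λ i j → (_ ℕ.≟ _) ⊎-dec (_ ℕ.≟ _)
  ; enumeration = ↔-id _
  }
cycle n = record
  { graph       = C n
  ; Adj?        = λ i j → ¬? (i Fin.≟ j) ×-dec ((j Fin.≟ next i) ⊎-dec (i Fin.≟ next j))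
  ; enumeration = ↔-id _
  }
complete n = record
  { graph       = K n
  ; Adj?        = λ i j → ¬? (i Fin.≟ j)
  ; enumeration = ↔-id _
  }

star₁₃ tripartite₁₁₂ : Template 4
star₁₃ = record
  { graph       = multipartite (1 ∷ 3 ∷ [])
  ; Adj?        = λ u v → ¬? (proj₁ u Fin.≟ proj₁ v)
  ; enumeration = mk↔ₛ′
      (λ { 0F → 0F , 0F ; 1F → 1F , 0F ; 2F → 1F , 1F ; 3F → 1F , 2F })
      (λ { (0F , 0F) → 0F ; (1F , 0F) → 1F ; (1F , 1F) → 2F ; (1F , 2F) → 3F })
      (λ { (0F , 0F) → refl ; (1F , 0F) → refl ; (1F , 1F) → refl ; (1F , 2F) → refl })
      (λ { 0F → refl ; 1F → refl ; 2F → refl ; 3F → refl })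
  }
tripartite₁₁₂ = record
  { graph       = multipartite (1 ∷ 1 ∷ 2 ∷ [])
  ; Adj?        = λ u v → ¬? (proj₁ u Fin.≟ proj₁ v)
  ; enumeration = mk↔ₛ′
      (λ { 0F → 0F , 0F ; 1F → 1F , 0F ; 2F → 2F , 0F ; 3F → 2F , 1F })
      (λ { (0F , 0F) → 0F ; (1F , 0F) → 1F ; (2F , 0F) → 2F ; (2F , 1F) → 3F })
      (λ { (0F , 0F) → refl ; (1F , 0F) → refl ; (2F , 0F) → refl ; (2F , 1F) → refl })
      (λ { 0F → refl ; 1F → refl ; 2F → refl ; 3F → refl })
  }

classify₂ : ∀ c → NoIsolated c → Realises (path 2) c
classify₂ = from-yes (allEdgeSet? λ c → noIsolated? c →-dec realises? (path 2) c)

classify₃ : ∀ c → NoIsolated c → Realises (complete 3) c ⊎ Realises (path 3) c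
classify₃ = from-yes (allEdgeSet? λ c → noIsolated? c →-dec
  (realises? (complete 3) c ⊎-dec realises? (path 3) c))

-- Up to isomorphism seven graphs on four vertices have no isolated vertex. Two disjoint edges, the
-- path and the triangle with a pendant edge have one perfect matching each and `K 4` has three. The
-- other graphs have two, none and two, in the order listed.
classify₄ : ∀ c → NoIsolated c → EvenMatchings c →
            Realises (cycle 4) c ⊎ Realises star₁₃ c ⊎ Realises tripartite₁₁₂ c
classify₄ = from-yes (allEdgeSet? λ c → noIsolated? c →-dec (evenMatchings? c →-dec
  (realises? (cycle 4) c ⊎-dec (realises? star₁₃ c ⊎-dec realises? tripartite₁₁₂ c))))

-- From edge sets back to oriented graphs

does-≡⇒⇔ : {A B : Set} (a? : Dec A) (b? : Dec B) → does a? ≡ does b? → A ⇔ B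
does-≡⇒⇔ (yes a) (yes b) _ = mk⇔ (λ _ → b) (λ _ → a)
does-≡⇒⇔ (no ¬a) (no ¬b) _ = mk⇔ (flip contradiction ¬a) (flip contradiction ¬b)

edges : OrientedGraph n → EdgeSet n
edges G = edgeSet _ (adjacent G)

mem-edges : (G : OrientedGraph n) → ∀ i j → mem (edges G) i j ≡ adjacent G i j
mem-edges G = mem-edgeSet (adjacent G) (adjacent-sym G) (adjacent-irrefl G)

realises⇒≅ : (G : OrientedGraph n) (T : Template n) → Realises T (edges G) → underlying G ≅ graph T
realises⇒≅ G T r with π , labelling ← Any.satisfied r = record
  { bijection = enumeration T ↔-∘ π
  ; preserves = λ i j → does-≡⇒⇔ (adj? G i j) (Adj? T _ _)
      (trans (sym (mem-edges G i j)) (labelling i j))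
  }

connected⇒neighbour : (H : SimpleGraph (Fin (suc (suc n)))) → Connected H → ∀ i → ∃ (Adj H i)
connected⇒neighbour H connected i
  -- `punchIn i 0F` is some vertex other than `i`, and the first step of a walk to it is the
  -- required edge. Abstracting it to a variable allows matching on `ε`.
  with punchIn i 0F | punchInᵢ≢i i 0F | connected i (punchIn i 0F)
... | _ | j≢i | ε     = contradiction refl j≢i
... | _ | _   | e ◅ _ = _ , e

connected⇒noIsolated : (G : OrientedGraph (suc (suc n))) → Connected (underlying G) →
                       NoIsolated (edges G)
connected⇒noIsolated G connected i with j , e ← connected⇒neighbour (underlying G) connected i =
  j , trans (mem-edges G i j) (adjacent-true G e)

evenMatchings : (G : OrientedGraph 4) → HasSkewRank G 2 → EvenMatchings (edges G)
evenMatchings G rank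
  rewrite mem-edges G 0F 1F | mem-edges G 2F 3F | mem-edges G 0F 2F
        | mem-edges G 1F 3F | mem-edges G 0F 3F | mem-edges G 1F 2F
  = matchings-even G rank λ i → i

theorem3p1 : (n : ℕ) (G : OrientedGraph n) →
    (n ≡ 2 ⊎ n ≡ 3 ⊎ n ≡ 4) →
    Connected (underlying G) →
    HasSkewRank G 2 →
    (n ≡ 2 → underlying G ≅ P 2) ×
    (n ≡ 3 → underlying G ≅ K 3 ⊎ underlying G ≅ P 3) ×
    (n ≡ 4 →
    (underlying G ≅ C 4 × EvenlyOriented G) ⊎
    (underlying G ≅ multipartite (1 ∷ 3 ∷ [])) ⊎
    (underlying G ≅ multipartite (1 ∷ 1 ∷ 2 ∷ []) × EvenlyOriented G))
theorem3p1 n G _ connected rank = order₂ , order₃ , order₄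
  where
  order₂ : n ≡ 2 → underlying G ≅ P 2
  order₂ refl = realises⇒≅ G (path 2) (classify₂ (edges G) (connected⇒noIsolated G connected))

  order₃ : n ≡ 3 → underlying G ≅ K 3 ⊎ underlying G ≅ P 3
  order₃ refl = Sum.map (realises⇒≅ G (complete 3)) (realises⇒≅ G (path 3))
    (classify₃ (edges G) (connected⇒noIsolated G connected))

  order₄ : n ≡ 4 →
    (underlying G ≅ C 4 × EvenlyOriented G) ⊎
    (underlying G ≅ multipartite (1 ∷ 3 ∷ [])) ⊎
    (underlying G ≅ multipartite (1 ∷ 1 ∷ 2 ∷ []) × EvenlyOriented G)
  order₄ refl = Sum.map
    (λ r → realises⇒≅ G (cycle 4) r , evenly-oriented G rank)
    (Sum.map
      (realises⇒≅ G star₁₃)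
      (λ r → realises⇒≅ G tripartite₁₁₂ r , evenly-oriented G rank))
    (classify₄ (edges G) (connected⇒noIsolated G connected) (evenMatchings G rank))
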